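{- For the Maximum Independent Set problem on a triangle-free graph with maximum degree $\Delta$, any greedy algorithm achieves an approximation ratio of $\frac{\Delta+6}{4}$. That is, for every triangle-free graph $G$ with maximum degree $\Delta$ and every independent set $S$ of $G$ produced by the minimum-degree greedy algorithm on $G$ (with arbitrary choices among minimum degree vertices), $\alpha(G)\le \frac{\Delta+6}{4}\,|S|$.
   Context: Graphs are finite, simple and undirected; $\alpha(G)$ denotes the maximum size of an independent set in $G$. The minimum-degree greedy algorithm starts with $S=\emptyset$; while the current graph is nonempty, it picks a vertex $v$ of minimum degree in the current graph, adds $v$ to $S$, and deletes $v$ and all its neighbours from the current graph. A greedy algorithm may use any rule to choose among several minimum degree vertices. -}

module Defs where

open import Data.Bool.Base using (true; false)
open import Data.Fin.Base using (Fin)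
import Data.Fin.Properties as Fin
open import Data.Fin.Subset
  using (Subset; inside; outside; _∈_; _∪_; _∩_; _─_; ⁅_⁆; ∣_∣; ⊤; ⊥; Empty)
open import Data.Fin.Subset.Properties using (_∈?_; ∉⊥; ∣⊥∣≡0)
open import Data.List.Base using (List; []; _∷_; _++_; map; filter; allFin)
open import Data.List.Extrema.Nat using (max; xs≤max; max≤v⁺; argmax-sel)
open import Data.List.Membership.Propositional
  using () renaming (_∈_ to _∈ˡ_)
open import Data.List.Membership.Propositional.Properties
  using (∈-map⁺; ∈-map⁻; ∈-++⁺ˡ; ∈-++⁺ʳ; ∈-filter⁺; ∈-filter⁻; ∈-allFin)
open import Data.List.Relation.Unary.Any using (here)
import Data.List.Relation.Unary.All as All
open import Data.Nat.Base using (ℕ; zero; suc; _≤_; z≤n)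
open import Data.Product.Base using (∃; _×_; _,_)
open import Data.Sum.Base using (inj₁; inj₂)
open import Data.Vec.Base using ([]; _∷_; tabulate)
open import Function.Base using (id)
open import Level using (0ℓ)
open import Relation.Binary.Core using (Rel)
open import Relation.Binary.Definitions using (Decidable; Symmetric)
open import Relation.Binary.PropositionalEquality
  using (_≡_; refl; sym; trans)
open import Relation.Nullary using (¬_; Dec; does)
open import Relation.Nullary.Decidable using (¬?; _→-dec_)

record Graph (n : ℕ) : Set₁ where
  field
    Adj       : Rel (Fin n) 0ℓ
    adj?      : Decidable Adj
    symmetric : Symmetric Adj
    loopless  : ∀ v → ¬ Adj v v

subsets : ∀ n → List (Subset n)
subsets zero    = [] ∷ []
subsets (suc n) = map (inside ∷_) (subsets n) ++ map (outside ∷_) (subsets n)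

module _ {n : ℕ} (G : Graph n) where
  open Graph G

  neighbours : Fin n → Subset n
  neighbours v = tabulate (λ w → does (adj? v w))

  -- The degree of v in the subgraph of G induced by U.
  degreeIn : Subset n → Fin n → ℕ
  degreeIn U v = ∣ neighbours v ∩ U ∣

  degree : Fin n → ℕ
  degree v = ∣ neighbours v ∣

  -- The graph without vertices gets maximum degree 0.
  maxDegree : ℕ
  maxDegree = max 0 (map degree (allFin n))

  TriangleFree : Set
  TriangleFree = ∀ u v w → Adj u v → Adj v w → ¬ Adj u w

  Independent : Subset n → Set
  Independent I = ∀ u v → u ∈ I → v ∈ I → ¬ Adj u v

  independent? : ∀ I → Dec (Independent I)
  independent? I = Fin.all? λ u → Fin.all? λ v →
    (u ∈? I) →-dec ((v ∈? I) →-dec ¬? (adj? u v))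

  α : ℕ
  α = max 0 (map ∣_∣ (filter independent? (subsets n)))

  MinDegreeIn : Subset n → Fin n → Set
  MinDegreeIn U v = v ∈ U × (∀ w → w ∈ U → degreeIn U v ≤ degreeIn U w)

  -- GreedyRun U S T: when the current graph is the one induced by U and the
  -- vertices of S have been chosen so far, some way of breaking the remaining
  -- ties makes the algorithm return T.
  data GreedyRun : (U S T : Subset n) → Set where
    stop : ∀ {U S} → Empty U → GreedyRun U S S
    pick : ∀ {U S T} v → MinDegreeIn U v →
           GreedyRun (U ─ (⁅ v ⁆ ∪ neighbours v)) (S ∪ ⁅ v ⁆) T →
           GreedyRun U S T

  GreedyOutput : Subset n → Set
  GreedyOutput = GreedyRun ⊤ ⊥

∈-subsets : ∀ {n} (p : Subset n) → p ∈ˡ subsets n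
∈-subsets []          = here refl
∈-subsets (true  ∷ p) = ∈-++⁺ˡ (∈-map⁺ (inside ∷_) (∈-subsets p))
∈-subsets {suc n} (false ∷ p) =
  ∈-++⁺ʳ (map (inside ∷_) (subsets n)) (∈-map⁺ (outside ∷_) (∈-subsets p))

module _ {n : ℕ} (G : Graph n) where

  degree≤maxDegree : ∀ v → degree G v ≤ maxDegree G
  degree≤maxDegree v =
    All.lookup (xs≤max 0 (map (degree G) (allFin n)))
               (∈-map⁺ (degree G) (∈-allFin v))

  maxDegree≤ : ∀ {d} → (∀ v → degree G v ≤ d) → maxDegree G ≤ d
  maxDegree≤ {d} bound = max≤v⁺ z≤n (All.tabulate bounded)
    where
    bounded : ∀ {k} → k ∈ˡ map (degree G) (allFin n) → k ≤ d
    bounded k∈ with v , _ , refl ← ∈-map⁻ (degree G) k∈ = bound v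

  ∣I∣≤α : ∀ I → Independent G I → ∣ I ∣ ≤ α G
  ∣I∣≤α I ind =
    All.lookup (xs≤max 0 (map ∣_∣ (filter (independent? G) (subsets n))))
               (∈-map⁺ ∣_∣ (∈-filter⁺ (independent? G) (∈-subsets I) ind))

  α-attained : ∃ λ I → Independent G I × ∣ I ∣ ≡ α G
  α-attained
    with argmax-sel id 0 (map ∣_∣ (filter (independent? G) (subsets n)))
  ... | inj₁ α≡0 = ⊥ , (λ u _ u∈⊥ → λ _ _ → ∉⊥ u∈⊥) , trans (∣⊥∣≡0 n) (sym α≡0)
  ... | inj₂ α∈
    with I , I∈ , α≡ ← ∈-map⁻ ∣_∣ α∈
    with _ , ind ← ∈-filter⁻ (independent? G) {xs = subsets n} I∈
    = I , ind , sym α≡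

{-# OPTIONS --safe #-}
module Submission where

-- Let k ≥ 1 bound all degrees.  If a greedy step picks a vertex of current
-- degree d, it removes d + 1 vertices and, the neighbours of that vertex being
-- independent and of degree at least d, at least d² edges.  Every edge has an
-- end outside an independent set I, so Σ d² ≤ k (n - ∣I∣), while
-- n = Σ (d + 1).  Hence k ∣I∣ ≤ Σ (k + k d - d²), and k d - d² ≤ k² / 4
-- yields 4 ∣I∣ ≤ (k + 4) ∣S∣.  Edges are counted as ordered pairs, that is
-- twice.

open import Defs
open import Data.Nat.Base using (ℕ)
open import Data.Integer.Base using (+_)
open import Data.Rational.Base using (_/_; _≤_; _*_)
open import Data.Fin.Subset using (Subset; ∣_∣)
import Data.Nat.Base as ℕ

open import Data.Bool.Base using (true; false)
open import Data.Fin.Base using (Fin; zero; suc)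
open import Data.Fin.Subset
  using (_∈_; _∉_; _⊆_; _∪_; _∩_; _─_; ⁅_⁆; ⊤; ⊥; ∁; Empty)
open import Data.Fin.Subset.Properties
  using (_∈?_; ∈⊤; ∉⊥; ∣⊥∣≡0; p⊆q⇒∣p∣≤∣q∣; x∈p∩q⁺; x∈p∩q⁻; x∈p∪q⁺; x∈p∪q⁻;
         x∈p∧x∉q⇒x∈p─q; p─q⊆p; p∩q⊆p; p∩q⊆q; p⊆p∪q; q⊆p∪q; ∣⁅x⁆∣≡1;
         x∈⁅y⁆⇒x≡y; x∉p⇒x∈∁p; x∈p⇒x∉∁p; Empty-unique)
import Data.Integer.Base as ℤ
import Data.Integer.Properties as ℤ
open import Data.Nat.Properties
open import Data.Nat.Tactic.RingSolver using (solve-∀)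
open import Data.Product.Base using (_,_; proj₁; proj₂)
open import Data.Rational.Properties
  using (toℚᵘ-cancel-≤; toℚᵘ-homo-*; toℚᵘ-fromℚᵘ)
open import Data.Rational.Unnormalised.Base as ℚᵘ using (mkℚᵘ; *≤*)
import Data.Rational.Unnormalised.Properties as ℚᵘ
open import Data.Sum.Base using (inj₁; inj₂)
open import Data.Vec.Base using ([]; _∷_; there)
open import Data.Vec.Properties using (lookup∘tabulate; []=⇒lookup; lookup⇒[]=)
open import Function.Base using (_∘_; const)
open import Relation.Binary.PropositionalEquality
open import Relation.Nullary using (yes; no; contradiction; does)
open import Relation.Nullary.Decidable using (dec-true)

open import Algebra.Properties.Semiring.Sum +-*-semiring
  using (sum; ∑-distrib-+; ∑-comm; *-distribˡ-sum; *-distribʳ-sum; sum-cong-≗)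

private
  variable
    n : ℕ

-- Elementary inequalities

sum-mono-≤ : ∀ {n} {f g : Fin n → ℕ} → (∀ i → f i ℕ.≤ g i) → sum f ℕ.≤ sum g
sum-mono-≤ {ℕ.zero}  f≤g = ℕ.z≤n
sum-mono-≤ {ℕ.suc n} f≤g = +-mono-≤ (f≤g zero) (sum-mono-≤ (f≤g ∘ suc))

-- With the larger number written as the smaller plus `j`, the two sides differ by `j * j`.
2mn≤m²+n² : ∀ m n → 2 ℕ.* (m ℕ.* n) ℕ.≤ m ℕ.* m ℕ.+ n ℕ.* n
2mn≤m²+n² m n with ≤-total m n
... | inj₁ m≤n with j , refl ← m≤n⇒∃[o]m+o≡n m≤n =
  ≤-trans (m≤m+n _ (j ℕ.* j)) (≤-reflexive (identity m j))
  where
  identity : ∀ m j → 2 ℕ.* (m ℕ.* (m ℕ.+ j)) ℕ.+ j ℕ.* j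
                   ≡ m ℕ.* m ℕ.+ (m ℕ.+ j) ℕ.* (m ℕ.+ j)
  identity = solve-∀
... | inj₂ n≤m with j , refl ← m≤n⇒∃[o]m+o≡n n≤m =
  ≤-trans (m≤m+n _ (j ℕ.* j)) (≤-reflexive (identity n j))
  where
  identity : ∀ n j → 2 ℕ.* ((n ℕ.+ j) ℕ.* n) ℕ.+ j ℕ.* j
                   ≡ (n ℕ.+ j) ℕ.* (n ℕ.+ j) ℕ.+ n ℕ.* n
  identity = solve-∀

-- Indicator functions and cardinalities

-- Numerical values turn cardinalities into sums, so that double counting becomes an exchange of
-- summations.
χ : Subset n → Fin n → ℕ
χ p i with i ∈? p
... | yes _ = 1
... | no  _ = 0

χ-∈ : ∀ {p : Subset n} {i} → i ∈ p → χ p i ≡ 1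
χ-∈ {p = p} {i} i∈p with i ∈? p
... | yes _   = refl
... | no  i∉p = contradiction i∈p i∉p

χ-∉ : ∀ {p : Subset n} {i} → i ∉ p → χ p i ≡ 0
χ-∉ {p = p} {i} i∉p with i ∈? p
... | yes i∈p = contradiction i∈p i∉p
... | no  _   = refl

χ-∩ : ∀ (p q : Subset n) i → χ (p ∩ q) i ≡ χ p i ℕ.* χ q i
χ-∩ p q i with i ∈? p | i ∈? q
... | yes i∈p | yes i∈q = χ-∈ (x∈p∩q⁺ (i∈p , i∈q))
... | yes _   | no  i∉q = χ-∉ (i∉q ∘ proj₂ ∘ x∈p∩q⁻ p q)
... | no  i∉p | _       = χ-∉ (i∉p ∘ proj₁ ∘ x∈p∩q⁻ p q)

χ-∷ : ∀ s (p : Subset n) i → χ (s ∷ p) (suc i) ≡ χ p i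
χ-∷ s p i with i ∈? p
... | yes _ = refl
... | no  _ = refl

∣p∣≡sum-χ : ∀ (p : Subset n) → ∣ p ∣ ≡ sum (χ p)
∣p∣≡sum-χ []          = refl
∣p∣≡sum-χ (true  ∷ p) =
  cong ℕ.suc (trans (∣p∣≡sum-χ p) (sum-cong-≗ (sym ∘ χ-∷ true p)))
∣p∣≡sum-χ (false ∷ p) = trans (∣p∣≡sum-χ p) (sum-cong-≗ (sym ∘ χ-∷ false p))

∣p∪q∣≤∣p∣+∣q∣ : ∀ (p q : Subset n) → ∣ p ∪ q ∣ ℕ.≤ ∣ p ∣ ℕ.+ ∣ q ∣
∣p∪q∣≤∣p∣+∣q∣ []          []          = ℕ.z≤n
∣p∪q∣≤∣p∣+∣q∣ (false ∷ p) (false ∷ q) = ∣p∪q∣≤∣p∣+∣q∣ p q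
∣p∪q∣≤∣p∣+∣q∣ (false ∷ p) (true  ∷ q) =
  ≤-trans (ℕ.s≤s (∣p∪q∣≤∣p∣+∣q∣ p q)) (≤-reflexive (sym (+-suc (∣ p ∣) (∣ q ∣))))
∣p∪q∣≤∣p∣+∣q∣ (true  ∷ p) (false ∷ q) = ℕ.s≤s (∣p∪q∣≤∣p∣+∣q∣ p q)
∣p∪q∣≤∣p∣+∣q∣ (true  ∷ p) (true  ∷ q) =
  ℕ.s≤s (≤-trans (∣p∪q∣≤∣p∣+∣q∣ p q) (+-monoʳ-≤ (∣ p ∣) (n≤1+n (∣ q ∣))))

disjoint⇒∣p∣+∣q∣≤∣r∣ : ∀ {p q r : Subset n} → p ⊆ r → q ⊆ r →
                       (∀ {i} → i ∈ p → i ∉ q) → ∣ p ∣ ℕ.+ ∣ q ∣ ℕ.≤ ∣ r ∣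
disjoint⇒∣p∣+∣q∣≤∣r∣ {p = p} {q} {r} p⊆r q⊆r disjoint = begin
  ∣ p ∣ ℕ.+ ∣ q ∣               ≡⟨ cong₂ ℕ._+_ (∣p∣≡sum-χ p) (∣p∣≡sum-χ q) ⟩
  sum (χ p) ℕ.+ sum (χ q)       ≡⟨ ∑-distrib-+ (χ p) (χ q) ⟨
  sum (λ i → χ p i ℕ.+ χ q i)   ≤⟨ sum-mono-≤ pointwise ⟩
  sum (χ r)                     ≡⟨ ∣p∣≡sum-χ r ⟨
  ∣ r ∣                         ∎
  where
  open ≤-Reasoning
  pointwise : ∀ i → χ p i ℕ.+ χ q i ℕ.≤ χ r i
  pointwise i with i ∈? p | i ∈? q
  ... | yes i∈p | yes i∈q = contradiction i∈q (disjoint i∈p)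
  ... | yes i∈p | no  _   = ≤-reflexive (sym (χ-∈ (p⊆r i∈p)))
  ... | no  _   | yes i∈q = ≤-reflexive (sym (χ-∈ (q⊆r i∈q)))
  ... | no  _   | no  _   = ℕ.z≤n

x∈p─q⇒x∉q : ∀ (p q : Subset n) {x} → x ∈ p ─ q → x ∉ q
x∈p─q⇒x∉q (_ ∷ p) (_     ∷ q) {suc x} (there x∈) (there x∈q) = x∈p─q⇒x∉q p q x∈ x∈q
x∈p─q⇒x∉q (_ ∷ p) (true  ∷ q) {zero}  ()
x∈p─q⇒x∉q (_ ∷ p) (false ∷ q) {zero}  _ ()

sumOver : Subset n → (Fin n → ℕ) → ℕ
sumOver p f = sum (λ i → χ p i ℕ.* f i)

sumOver-mono-≤ : ∀ (p : Subset n) {f g : Fin n → ℕ} →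
                 (∀ i → i ∈ p → f i ℕ.≤ g i) → sumOver p f ℕ.≤ sumOver p g
sumOver-mono-≤ p {f} {g} f≤g = sum-mono-≤ pointwise
  where
  pointwise : ∀ i → χ p i ℕ.* f i ℕ.≤ χ p i ℕ.* g i
  pointwise i with i ∈? p
  ... | yes i∈p = *-monoʳ-≤ 1 (f≤g i i∈p)
  ... | no  _   = ℕ.z≤n

sumOver-const : ∀ (p : Subset n) k → sumOver p (const k) ≡ ∣ p ∣ ℕ.* k
sumOver-const p k =
  trans (sym (*-distribʳ-sum k (χ p))) (cong (ℕ._* k) (sym (∣p∣≡sum-χ p)))

-- Counting adjacent pairs

module _ {n : ℕ} (G : Graph n) where
  open Graph G

  private
    N : Fin n → Subset n
    N = neighbours G

  ∈-neighbours⁺ : ∀ {v w} → Adj v w → w ∈ N v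
  ∈-neighbours⁺ {v} {w} vw = lookup⇒[]= w (N v)
    (trans (lookup∘tabulate (does ∘ adj? v) w) (dec-true (adj? v w) vw))

  ∈-neighbours⁻ : ∀ {v w} → w ∈ N v → Adj v w
  ∈-neighbours⁻ {v} {w} w∈
    with adj? v w
       | trans (sym (lookup∘tabulate (does ∘ adj? v) w)) ([]=⇒lookup w∈)
  ... | yes vw | _ = vw

  χ-neighbours-sym : ∀ v w → χ (N v) w ≡ χ (N w) v
  χ-neighbours-sym v w with w ∈? N v
  ... | yes w∈ = sym (χ-∈ (∈-neighbours⁺ (symmetric (∈-neighbours⁻ w∈))))
  ... | no  w∉ = sym (χ-∉ (w∉ ∘ ∈-neighbours⁺ ∘ symmetric ∘ ∈-neighbours⁻))

  -- Adjacent pairs (u , w) with u ∈ P and w ∈ Q, so that pairs P P is twice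
  -- the number of edges inside P.
  pairs : Subset n → Subset n → ℕ
  pairs P Q = sumOver P (degreeIn G Q)

  pairs-double-sum : ∀ P Q → pairs P Q
    ≡ sum (λ u → sum (λ w → χ P u ℕ.* (χ (N u) w ℕ.* χ Q w)))
  pairs-double-sum P Q = sum-cong-≗ λ u →
    trans (cong (χ P u ℕ.*_)
                (trans (∣p∣≡sum-χ (N u ∩ Q)) (sum-cong-≗ (χ-∩ (N u) Q))))
          (*-distribˡ-sum (χ P u) (λ w → χ (N u) w ℕ.* χ Q w))

  -- Exchanging the two summations reverses every pair, and adjacency is symmetric.
  pairs-sym : ∀ P Q → pairs P Q ≡ pairs Q P
  pairs-sym P Q = begin
    pairs P Q
      ≡⟨ pairs-double-sum P Q ⟩
    sum (λ u → sum (λ w → χ P u ℕ.* (χ (N u) w ℕ.* χ Q w)))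
      ≡⟨ ∑-comm (λ u w → χ P u ℕ.* (χ (N u) w ℕ.* χ Q w)) ⟩
    sum (λ w → sum (λ u → χ P u ℕ.* (χ (N u) w ℕ.* χ Q w)))
      ≡⟨ sum-cong-≗ (λ w → sum-cong-≗ (λ u →
           trans (reverse (χ P u) (χ (N u) w) (χ Q w))
                 (cong (λ a → χ Q w ℕ.* (a ℕ.* χ P u)) (χ-neighbours-sym u w)))) ⟩
    sum (λ w → sum (λ u → χ Q w ℕ.* (χ (N w) u ℕ.* χ P u)))
      ≡⟨ pairs-double-sum Q P ⟨
    pairs Q P
      ∎
    where
    open ≡-Reasoning
    reverse : ∀ x y z → x ℕ.* (y ℕ.* z) ≡ z ℕ.* (y ℕ.* x)
    reverse = solve-∀

  pairs-≤ : ∀ P Q {k} → (∀ u → degree G u ℕ.≤ k) → pairs P Q ℕ.≤ ∣ P ∣ ℕ.* k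
  pairs-≤ P Q {k} bound = ≤-trans
    (sumOver-mono-≤ P λ u _ →
      ≤-trans (p⊆q⇒∣p∣≤∣q∣ (p∩q⊆p (N u) Q)) (bound u))
    (≤-reflexive (sumOver-const P k))

  -- Pairs are sorted by their first end. If it lies in `I`, the second end lies in `∁ I`, and
  -- reversing the pair makes it start there too. Each of the two classes thus has at most `k` pairs
  -- per vertex of `∁ I`.
  pairs-≤-∁independent : ∀ I {k} → Independent G I →
    (∀ u → degree G u ℕ.≤ k) → pairs ⊤ ⊤ ℕ.≤ 2 ℕ.* (∣ ∁ I ∣ ℕ.* k)
  pairs-≤-∁independent I {k} indep bound = begin
    pairs ⊤ ⊤
      ≤⟨ sum-mono-≤ split ⟩
    sum (λ u → χ I u ℕ.* degreeIn G (∁ I) u ℕ.+ χ (∁ I) u ℕ.* degreeIn G ⊤ u)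
      ≡⟨ ∑-distrib-+ (λ u → χ I u ℕ.* degreeIn G (∁ I) u)
                     (λ u → χ (∁ I) u ℕ.* degreeIn G ⊤ u) ⟩
    pairs I (∁ I) ℕ.+ pairs (∁ I) ⊤
      ≡⟨ cong (ℕ._+ pairs (∁ I) ⊤) (pairs-sym I (∁ I)) ⟩
    pairs (∁ I) I ℕ.+ pairs (∁ I) ⊤
      ≤⟨ +-mono-≤ (pairs-≤ (∁ I) I bound) (pairs-≤ (∁ I) ⊤ bound) ⟩
    ∣ ∁ I ∣ ℕ.* k ℕ.+ ∣ ∁ I ∣ ℕ.* k
      ≡⟨ cong (∣ ∁ I ∣ ℕ.* k ℕ.+_) (+-identityʳ _) ⟨
    2 ℕ.* (∣ ∁ I ∣ ℕ.* k)
      ∎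
    where
    open ≤-Reasoning
    split : ∀ u → χ ⊤ u ℕ.* degreeIn G ⊤ u
            ℕ.≤ χ I u ℕ.* degreeIn G (∁ I) u ℕ.+ χ (∁ I) u ℕ.* degreeIn G ⊤ u
    split u rewrite χ-∈ (∈⊤ {x = u}) with u ∈? I
    ... | yes u∈I = ≤-trans
      (*-monoʳ-≤ 1 (p⊆q⇒∣p∣≤∣q∣ λ {w} w∈ →
        let w∈N = p∩q⊆p (N u) ⊤ w∈ in
        x∈p∩q⁺ (w∈N , x∉p⇒x∈∁p λ w∈I → indep u w u∈I w∈I (∈-neighbours⁻ w∈N))))
      (m≤m+n _ _)
    ... | no  u∉I rewrite χ-∈ (x∉p⇒x∈∁p u∉I) = ≤-refl

  -- A single greedy step

  module _ (triangleFree : TriangleFree G)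
           {U : Subset n} {v : Fin n} (minDeg : MinDegreeIn G U v) where

    private
      v∈U : v ∈ U
      v∈U = proj₁ minDeg

      d : ℕ
      d = degreeIn G U v

      NU R U′ : Subset n
      NU = N v ∩ U
      R  = ⁅ v ⁆ ∪ N v
      U′ = U ─ R

      NU⊆U : NU ⊆ U
      NU⊆U = p∩q⊆q (N v) U

      U′⊆U : U′ ⊆ U
      U′⊆U = p─q⊆p U R

      U′-NU-disjoint : ∀ {w} → w ∈ U′ → w ∉ NU
      U′-NU-disjoint w∈U′ w∈NU =
        x∈p─q⇒x∉q U R w∈U′ (q⊆p∪q ⁅ v ⁆ (N v) (p∩q⊆p (N v) U w∈NU))

      -- Two adjacent neighbours of `v` would form a triangle with it.
      no-neighbour-in-NU : ∀ {u} → u ∈ NU → degreeIn G NU u ≡ 0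
      no-neighbour-in-NU {u} u∈NU = trans (cong ∣_∣ (Empty-unique empty)) (∣⊥∣≡0 n)
        where
        empty : Empty (N u ∩ NU)
        empty (w , w∈) with w∈Nu , w∈NU ← x∈p∩q⁻ (N u) NU w∈ =
          triangleFree v u w (∈-neighbours⁻ (p∩q⊆p (N v) U u∈NU))
            (∈-neighbours⁻ w∈Nu) (∈-neighbours⁻ (p∩q⊆p (N v) U w∈NU))

      -- The three terms count pairs starting at `u`: those inside `U′`, those with first end in
      -- `NU`, and those with second end in `NU`. No pair is counted twice, since `NU` is
      -- independent and disjoint from `U′`.
      split : ∀ u → χ U′ u ℕ.* degreeIn G U′ u
                    ℕ.+ (χ NU u ℕ.* degreeIn G U u ℕ.+ χ U u ℕ.* degreeIn G NU u)
              ℕ.≤ χ U u ℕ.* degreeIn G U u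
      split u with u ∈? NU
      ... | yes u∈NU
        rewrite χ-∉ (λ u∈U′ → U′-NU-disjoint u∈U′ u∈NU)
              | χ-∈ (NU⊆U u∈NU)
              | no-neighbour-in-NU u∈NU = ≤-reflexive (+-identityʳ _)
      ... | no _ with u ∈? U′
      ... | yes u∈U′
        rewrite χ-∈ (U′⊆U u∈U′)
              | +-identityʳ (degreeIn G U′ u)
              | +-identityʳ (degreeIn G NU u)
              | +-identityʳ (degreeIn G U u) =
        disjoint⇒∣p∣+∣q∣≤∣r∣
          (∩-monoʳ U′⊆U) (∩-monoʳ NU⊆U)
          (λ w∈ w∈′ → U′-NU-disjoint (p∩q⊆q (N u) U′ w∈) (p∩q⊆q (N u) NU w∈′))
        where
        ∩-monoʳ : ∀ {P Q} → P ⊆ Q → N u ∩ P ⊆ N u ∩ Q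
        ∩-monoʳ {P} P⊆Q w∈ with w∈N , w∈P ← x∈p∩q⁻ (N u) P w∈ =
          x∈p∩q⁺ (w∈N , P⊆Q w∈P)
      -- Only the third term is left: `u` is `v` or lies outside `U`.
      ... | no _ = *-monoʳ-≤ (χ U u) (p⊆q⇒∣p∣≤∣q∣ λ w∈ →
        x∈p∩q⁺ (p∩q⊆p (N u) NU w∈ , NU⊆U (p∩q⊆q (N u) NU w∈)))

    -- By minimality of `d`, each of the `d` vertices of `NU` has degree at least `d` in `U`. So at
    -- least d² of the lost pairs start in `NU`, and by symmetry at least d² others end there.
    removed-pairs : pairs U′ U′ ℕ.+ 2 ℕ.* (d ℕ.* d) ℕ.≤ pairs U U
    removed-pairs = begin
      pairs U′ U′ ℕ.+ 2 ℕ.* (d ℕ.* d)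
        ≡⟨ cong (λ x → pairs U′ U′ ℕ.+ (d ℕ.* d ℕ.+ x)) (+-identityʳ _) ⟩
      pairs U′ U′ ℕ.+ (d ℕ.* d ℕ.+ d ℕ.* d)
        ≤⟨ +-monoʳ-≤ (pairs U′ U′) (+-mono-≤ d²≤ d²≤) ⟩
      pairs U′ U′ ℕ.+ (pairs NU U ℕ.+ pairs NU U)
        ≡⟨ cong (λ x → pairs U′ U′ ℕ.+ (pairs NU U ℕ.+ x)) (pairs-sym NU U) ⟩
      pairs U′ U′ ℕ.+ (pairs NU U ℕ.+ pairs U NU)
        ≡⟨ cong (pairs U′ U′ ℕ.+_) (∑-distrib-+ f g) ⟨
      pairs U′ U′ ℕ.+ sum (λ u → f u ℕ.+ g u)
        ≡⟨ ∑-distrib-+ (λ u → χ U′ u ℕ.* degreeIn G U′ u) (λ u → f u ℕ.+ g u) ⟨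
      sum (λ u → χ U′ u ℕ.* degreeIn G U′ u ℕ.+ (f u ℕ.+ g u))
        ≤⟨ sum-mono-≤ split ⟩
      pairs U U
        ∎
      where
      open ≤-Reasoning
      f g : Fin n → ℕ
      f u = χ NU u ℕ.* degreeIn G U u
      g u = χ U u ℕ.* degreeIn G NU u

      d²≤ : d ℕ.* d ℕ.≤ pairs NU U
      d²≤ = ≤-trans (≤-reflexive (sym (sumOver-const NU d)))
                    (sumOver-mono-≤ NU λ u u∈NU → proj₂ minDeg u (NU⊆U u∈NU))

    -- `R` may contain neighbours of `v` that were deleted earlier; covering `U` with `NU` in place
    -- of `N v` charges only the current degree `d`.
    removed-vertices : ∣ U ∣ ℕ.≤ ∣ U′ ∣ ℕ.+ (1 ℕ.+ d)
    removed-vertices = begin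
      ∣ U ∣                              ≤⟨ p⊆q⇒∣p∣≤∣q∣ cover ⟩
      ∣ U′ ∪ (⁅ v ⁆ ∪ NU) ∣              ≤⟨ ∣p∪q∣≤∣p∣+∣q∣ U′ (⁅ v ⁆ ∪ NU) ⟩
      ∣ U′ ∣ ℕ.+ ∣ ⁅ v ⁆ ∪ NU ∣          ≤⟨ +-monoʳ-≤ (∣ U′ ∣) (∣p∪q∣≤∣p∣+∣q∣ ⁅ v ⁆ NU) ⟩
      ∣ U′ ∣ ℕ.+ (∣ ⁅ v ⁆ ∣ ℕ.+ d)       ≡⟨ cong (λ x → ∣ U′ ∣ ℕ.+ (x ℕ.+ d)) (∣⁅x⁆∣≡1 v) ⟩
      ∣ U′ ∣ ℕ.+ (1 ℕ.+ d)               ∎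
      where
      open ≤-Reasoning
      cover : U ⊆ U′ ∪ (⁅ v ⁆ ∪ NU)
      cover {w} w∈U with w ∈? R
      ... | no  w∉R = x∈p∪q⁺ (inj₁ (x∈p∧x∉q⇒x∈p─q w∈U w∉R))
      ... | yes w∈R with x∈p∪q⁻ ⁅ v ⁆ (N v) w∈R
      ...   | inj₁ w∈v = x∈p∪q⁺ (inj₂ (x∈p∪q⁺ (inj₁ w∈v)))
      ...   | inj₂ w∈N = x∈p∪q⁺ (inj₂ (x∈p∪q⁺ (inj₂ (x∈p∩q⁺ (w∈N , w∈U)))))

    -- Preserves the invariant under which `v` counts as a new element of the output.
    chosen-disjoint : ∀ {S} → (∀ {w} → w ∈ U → w ∉ S) →
                      ∀ {w} → w ∈ U′ → w ∉ S ∪ ⁅ v ⁆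
    chosen-disjoint {S} disjoint w∈U′ w∈S∪v with x∈p∪q⁻ S ⁅ v ⁆ w∈S∪v
    ... | inj₁ w∈S = disjoint (U′⊆U w∈U′) w∈S
    ... | inj₂ w∈v = x∈p─q⇒x∉q U R w∈U′ (p⊆p∪q (N v) w∈v)

    chosen-grows : ∀ {S} → (∀ {w} → w ∈ U → w ∉ S) → 1 ℕ.+ ∣ S ∣ ℕ.≤ ∣ S ∪ ⁅ v ⁆ ∣
    chosen-grows {S} disjoint = begin
      1 ℕ.+ ∣ S ∣          ≡⟨ cong (ℕ._+ ∣ S ∣) (∣⁅x⁆∣≡1 v) ⟨
      ∣ ⁅ v ⁆ ∣ ℕ.+ ∣ S ∣  ≤⟨ disjoint⇒∣p∣+∣q∣≤∣r∣ (q⊆p∪q S ⁅ v ⁆) (p⊆p∪q ⁅ v ⁆) v∉S ⟩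
      ∣ S ∪ ⁅ v ⁆ ∣        ∎
      where
      open ≤-Reasoning
      v∉S : ∀ {w} → w ∈ ⁅ v ⁆ → w ∉ S
      v∉S w∈v w∈S rewrite x∈⁅y⁆⇒x≡y v w∈v = disjoint v∈U w∈S

  -- Summation over a run

  -- A step lowers 4k∣U∣ by at most 4k(d + 1) and twice the pair count by at least 4d². The
  -- difference is at most k(k + 4), which the new element of the output pays for. Terms are placed
  -- so that no subtraction occurs.
  run-bound : ∀ k → TriangleFree G → ∀ {U S T} → GreedyRun G U S T →
    (∀ {w} → w ∈ U → w ∉ S) →
    4 ℕ.* k ℕ.* ∣ U ∣ ℕ.+ k ℕ.* (k ℕ.+ 4) ℕ.* ∣ S ∣
      ℕ.≤ 2 ℕ.* pairs U U ℕ.+ k ℕ.* (k ℕ.+ 4) ℕ.* ∣ T ∣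
  run-bound k tf {U} {S} (stop empty) disjoint
    rewrite Empty-unique empty | ∣⊥∣≡0 n | *-zeroʳ (4 ℕ.* k) = m≤n+m _ _
  run-bound k tf {U} {S} {T} (pick v minDeg run) disjoint =
    +-cancelʳ-≤ (4 ℕ.* (d ℕ.* d)) _ _ (begin
      4 ℕ.* k ℕ.* ∣ U ∣ ℕ.+ c ℕ.* ∣ S ∣ ℕ.+ 4 ℕ.* (d ℕ.* d)
        ≤⟨ +-monoˡ-≤ _ (+-monoˡ-≤ _ (*-monoʳ-≤ (4 ℕ.* k) (removed-vertices tf minDeg))) ⟩
      4 ℕ.* k ℕ.* (∣ U′ ∣ ℕ.+ (1 ℕ.+ d)) ℕ.+ c ℕ.* ∣ S ∣ ℕ.+ 4 ℕ.* (d ℕ.* d)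
        ≡⟨ expand k (∣ U′ ∣) d (∣ S ∣) ⟩
      2 ℕ.* (k ℕ.* (2 ℕ.* d)) ℕ.+ rest
        -- This is 4kd ≤ k² + 4d², the bound k d - d² ≤ k² / 4 without division.
        ≤⟨ +-monoˡ-≤ rest (2mn≤m²+n² k (2 ℕ.* d)) ⟩
      k ℕ.* k ℕ.+ 2 ℕ.* d ℕ.* (2 ℕ.* d) ℕ.+ rest
        ≡⟨ collect k (∣ U′ ∣) d (∣ S ∣) ⟩
      4 ℕ.* k ℕ.* ∣ U′ ∣ ℕ.+ c ℕ.* (1 ℕ.+ ∣ S ∣) ℕ.+ 8 ℕ.* (d ℕ.* d)
        ≤⟨ +-monoˡ-≤ _ (+-monoʳ-≤ (4 ℕ.* k ℕ.* ∣ U′ ∣)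
             (*-monoʳ-≤ c (chosen-grows tf minDeg disjoint))) ⟩
      4 ℕ.* k ℕ.* ∣ U′ ∣ ℕ.+ c ℕ.* ∣ S ∪ ⁅ v ⁆ ∣ ℕ.+ 8 ℕ.* (d ℕ.* d)
        ≤⟨ +-monoˡ-≤ _ (run-bound k tf run (chosen-disjoint tf minDeg disjoint)) ⟩
      2 ℕ.* pairs U′ U′ ℕ.+ c ℕ.* ∣ T ∣ ℕ.+ 8 ℕ.* (d ℕ.* d)
        -- Half of the 8d² is absorbed by the pairs removed in this step; the other half is the
        -- summand cancelled at the end.
        ≡⟨ regroup (pairs U′ U′) (c ℕ.* ∣ T ∣) (d ℕ.* d) ⟩
      2 ℕ.* (pairs U′ U′ ℕ.+ 2 ℕ.* (d ℕ.* d)) ℕ.+ c ℕ.* ∣ T ∣ ℕ.+ 4 ℕ.* (d ℕ.* d)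
        ≤⟨ +-monoˡ-≤ _ (+-monoˡ-≤ _ (*-monoʳ-≤ 2 (removed-pairs tf minDeg))) ⟩
      2 ℕ.* pairs U U ℕ.+ c ℕ.* ∣ T ∣ ℕ.+ 4 ℕ.* (d ℕ.* d)
        ∎)
    where
    open ≤-Reasoning
    c d rest : ℕ
    U′ : Subset n
    c = k ℕ.* (k ℕ.+ 4)
    d = degreeIn G U v
    U′ = U ─ (⁅ v ⁆ ∪ N v)
    rest = 4 ℕ.* k ℕ.* ∣ U′ ∣ ℕ.+ 4 ℕ.* k ℕ.+ c ℕ.* ∣ S ∣ ℕ.+ 4 ℕ.* (d ℕ.* d)

    expand : ∀ k u d s →
      4 ℕ.* k ℕ.* (u ℕ.+ (1 ℕ.+ d)) ℕ.+ k ℕ.* (k ℕ.+ 4) ℕ.* s ℕ.+ 4 ℕ.* (d ℕ.* d)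
      ≡ 2 ℕ.* (k ℕ.* (2 ℕ.* d)) ℕ.+
        (4 ℕ.* k ℕ.* u ℕ.+ 4 ℕ.* k ℕ.+ k ℕ.* (k ℕ.+ 4) ℕ.* s ℕ.+ 4 ℕ.* (d ℕ.* d))
    expand = solve-∀

    collect : ∀ k u d s →
      k ℕ.* k ℕ.+ 2 ℕ.* d ℕ.* (2 ℕ.* d) ℕ.+
        (4 ℕ.* k ℕ.* u ℕ.+ 4 ℕ.* k ℕ.+ k ℕ.* (k ℕ.+ 4) ℕ.* s ℕ.+ 4 ℕ.* (d ℕ.* d))
      ≡ 4 ℕ.* k ℕ.* u ℕ.+ k ℕ.* (k ℕ.+ 4) ℕ.* (1 ℕ.+ s) ℕ.+ 8 ℕ.* (d ℕ.* d)
    collect = solve-∀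

    regroup : ∀ x y z → 2 ℕ.* x ℕ.+ y ℕ.+ 8 ℕ.* z
                      ≡ 2 ℕ.* (x ℕ.+ 2 ℕ.* z) ℕ.+ y ℕ.+ 4 ℕ.* z
    regroup = solve-∀

  -- The run on the whole graph is compared with the edge bound for `I`. Since ∣I∣ + ∣∁ I∣ ≤ n, the
  -- terms in `∁ I` cancel, and then the nonzero factor `k` does.
  greedy-bound : ∀ k .{{_ : ℕ.NonZero k}} → (∀ v → degree G v ℕ.≤ k) →
    TriangleFree G → ∀ {I S} → Independent G I → GreedyOutput G S →
    4 ℕ.* ∣ I ∣ ℕ.≤ (k ℕ.+ 4) ℕ.* ∣ S ∣
  greedy-bound k bound tf {I} {S} indep run =
    *-cancelˡ-≤ k (+-cancelʳ-≤ (4 ℕ.* k ℕ.* ∣ ∁ I ∣) _ _ (begin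
      k ℕ.* (4 ℕ.* ∣ I ∣) ℕ.+ 4 ℕ.* k ℕ.* ∣ ∁ I ∣
        ≡⟨ factor k (∣ I ∣) (∣ ∁ I ∣) ⟩
      4 ℕ.* k ℕ.* (∣ I ∣ ℕ.+ ∣ ∁ I ∣)
        ≤⟨ *-monoʳ-≤ (4 ℕ.* k)
             (disjoint⇒∣p∣+∣q∣≤∣r∣ {p = I} {r = ⊤} (λ _ → ∈⊤) (λ _ → ∈⊤) x∈p⇒x∉∁p) ⟩
      4 ℕ.* k ℕ.* ∣ ⊤ {n} ∣
        ≤⟨ m≤m+n _ _ ⟩
      4 ℕ.* k ℕ.* ∣ ⊤ {n} ∣ ℕ.+ k ℕ.* (k ℕ.+ 4) ℕ.* ∣ ⊥ {n} ∣
        ≤⟨ run-bound k tf run (λ _ → ∉⊥) ⟩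
      2 ℕ.* pairs ⊤ ⊤ ℕ.+ k ℕ.* (k ℕ.+ 4) ℕ.* ∣ S ∣
        ≤⟨ +-monoˡ-≤ _ (*-monoʳ-≤ 2 (pairs-≤-∁independent I indep bound)) ⟩
      2 ℕ.* (2 ℕ.* (∣ ∁ I ∣ ℕ.* k)) ℕ.+ k ℕ.* (k ℕ.+ 4) ℕ.* ∣ S ∣
        ≡⟨ rearrange k (∣ ∁ I ∣) (∣ S ∣) ⟩
      k ℕ.* ((k ℕ.+ 4) ℕ.* ∣ S ∣) ℕ.+ 4 ℕ.* k ℕ.* ∣ ∁ I ∣
        ∎))
    where
    open ≤-Reasoning
    factor : ∀ k i j → k ℕ.* (4 ℕ.* i) ℕ.+ 4 ℕ.* k ℕ.* j ≡ 4 ℕ.* k ℕ.* (i ℕ.+ j)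
    factor = solve-∀

    rearrange : ∀ k j s → 2 ℕ.* (2 ℕ.* (j ℕ.* k)) ℕ.+ k ℕ.* (k ℕ.+ 4) ℕ.* s
                        ≡ k ℕ.* ((k ℕ.+ 4) ℕ.* s) ℕ.+ 4 ℕ.* k ℕ.* j
    rearrange = solve-∀

-- The rational form of the bound

-- Since `_/_` reduces to lowest terms, the comparison is made among unnormalised rationals, where
-- it is cross multiplication. `mkℚᵘ` stores the denominator minus one, so `mkℚᵘ (+ b) 3` is b / 4.
a≤[b/4]c : ∀ a b c → 4 ℕ.* a ℕ.≤ b ℕ.* c → + a / 1 ≤ (+ b / 4) * (+ c / 1)
a≤[b/4]c a b c 4a≤bc = toℚᵘ-cancel-≤ (begin
  _                             ≃⟨ toℚᵘ-fromℚᵘ (mkℚᵘ (+ a) 0) ⟩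
  mkℚᵘ (+ a) 0                  ≤⟨ *≤* (subst₂ ℤ._≤_ lhs rhs (ℤ.+≤+ 4a≤bc)) ⟩
  mkℚᵘ (+ b) 3 ℚᵘ.* mkℚᵘ (+ c) 0
    ≃⟨ ℚᵘ.*-cong (toℚᵘ-fromℚᵘ (mkℚᵘ (+ b) 3)) (toℚᵘ-fromℚᵘ (mkℚᵘ (+ c) 0)) ⟨
  _                             ≃⟨ toℚᵘ-homo-* (+ b / 4) (+ c / 1) ⟨
  _                             ∎)
  where
  open ℚᵘ.≤-Reasoning
  lhs : + (4 ℕ.* a) ≡ + a ℤ.* + 4
  lhs = trans (cong +_ (*-comm 4 a)) (ℤ.pos-* a 4)
  rhs : + (b ℕ.* c) ≡ (+ b ℤ.* + c) ℤ.* + 1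
  rhs = trans (ℤ.pos-* b c) (sym (ℤ.*-identityʳ _))

theorem5 : ∀ {n : ℕ} (G : Graph n) → TriangleFree G →
    (S : Subset n) → GreedyOutput G S →
    + α G / 1 ≤ (+ (maxDegree G ℕ.+ 6) / 4) * (+ ∣ S ∣ / 1)
theorem5 G triangleFree S run
  with I , indep , ∣I∣≡α ← α-attained G =
  a≤[b/4]c (α G) (maxDegree G ℕ.+ 6) ∣ S ∣
    -- For k = 2 + Δ the factor k + 4 is exactly Δ + 6.
    (subst₂ (λ a b → 4 ℕ.* a ℕ.≤ b ℕ.* ∣ S ∣) ∣I∣≡α (shift Δ)
      -- Unlike Δ itself, 2 + Δ is nonzero even for an edgeless graph.
      (greedy-bound G (2 ℕ.+ Δ) (λ v → m≤n⇒m≤o+n 2 (degree≤maxDegree G v))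
        triangleFree indep run))
  where
  Δ : ℕ
  Δ = maxDegree G
  shift : ∀ Δ → 2 ℕ.+ Δ ℕ.+ 4 ≡ Δ ℕ.+ 6
  shift = solve-∀
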